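{- Let $n$ be a positive integer and let $a_1,a_2,\ldots,a_n$ be strictly positive real numbers. Let $A_R(n)=[A_R(i,j)]_{i,j=1}^n$ be the matrix with $A_R(i,j)=1$ if $j=1$ and $i\neq 1$; $A_R(i,j)=a_i$ if $i\mid j$; and $A_R(i,j)=0$ otherwise. Then \[ \det(A_R(n))=\left(\prod_{j=1}^n a_j\right)\left[1+\sum_{k=2}^{n}\frac{\mu(k)}{a_k}\right]. \]
   Context: $\mu$ denotes the Möbius function: $\mu(1)=1$, $\mu(j)=0$ if $j$ has a repeated prime factor, and $\mu(j)=(-1)^k$ if $j$ is a product of $k$ distinct primes. -}

module Defs where

open import Algebra.Bundles.Raw using (RawRing)
import Algebra.Definitions.RawMonoid as RawMonoidDefs
import Algebra.Definitions.RawSemiring as RawSemiringDefs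
open import Data.Bool.Base using (if_then_else_; not; _∧_)
open import Data.Fin.Base as Fin using (Fin; toℕ; punchIn)
open import Data.Integer.Base as ℤ using (ℤ; 0ℤ; -1ℤ)
open import Data.List.Base using (length)
open import Data.List.Relation.Unary.Unique.DecPropositional using (unique?)
open import Data.Nat.Base as ℕ using (ℕ; zero; suc; _⊔_)
open import Data.Nat.Divisibility using (_∣?_)
import Data.Nat.Properties as ℕₚ
open import Data.Nat.Primality.Factorisation using (factors; factorise)
open import Data.Product.Base using (∃-syntax; _×_; _,_; proj₁; proj₂)
open import Data.Rational.Base as ℚ using (ℚ; 0ℚ; 1ℚ; ½; ∣_∣)
import Data.Rational.Properties as ℚₚ
open import Data.Rational.Solver using (module +-*-Solver)
open import Data.Vec.Functional using (Vector)
open import Level using (0ℓ)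
open import Relation.Binary.PropositionalEquality using (_≡_; refl; sym; trans; cong; cong₂; subst; subst₂)
open import Relation.Nullary using (does; yes; no; contradiction)

------------------------------------------------------------------------
-- Real numbers: Cauchy sequences of rationals, with the setoid equality
-- "the difference tends to 0" and termwise operations.

IsCauchy : (ℕ → ℚ) → Set
IsCauchy x = ∀ ε → 0ℚ ℚ.< ε →
  ∃[ N ] (∀ m n → N ℕ.≤ m → N ℕ.≤ n → ∣ x m ℚ.- x n ∣ ℚ.< ε)

record ℝ : Set where
  constructor mkℝ
  field
    seq    : ℕ → ℚ
    cauchy : IsCauchy seq

open ℝ public

infix 4 _≈_ _<_

_≈_ : ℝ → ℝ → Set
x ≈ y = ∀ ε → 0ℚ ℚ.< ε →
  ∃[ N ] (∀ n → N ℕ.≤ n → ∣ seq x n ℚ.- seq y n ∣ ℚ.< ε)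

_<_ : ℝ → ℝ → Set
x < y = ∃[ ε ] (0ℚ ℚ.< ε × ∃[ N ] (∀ n → N ℕ.≤ n → ε ℚ.≤ seq y n ℚ.- seq x n))

module CauchyLemmas where
  open +-*-Solver

  *-pos : ∀ {p q} → 0ℚ ℚ.< p → 0ℚ ℚ.< q → 0ℚ ℚ.< p ℚ.* q
  *-pos {p} {q} 0<p 0<q =
    ℚₚ.positive⁻¹ (p ℚ.* q)
      {{ℚₚ.pos*pos⇒pos p {{ℚ.positive 0<p}} q {{ℚ.positive 0<q}}}}

  0<½ : 0ℚ ℚ.< ½
  0<½ = ℚₚ.positive⁻¹ ½

  ½+½ : ∀ p → ½ ℚ.* p ℚ.+ ½ ℚ.* p ≡ p
  ½+½ p = trans (sym (ℚₚ.*-distribʳ-+ p ½ ½)) (ℚₚ.*-identityˡ p)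

  eventuallyBounded : ∀ x → IsCauchy x →
    ∃[ K ] (0ℚ ℚ.< K × ∃[ N ] (∀ n → N ℕ.≤ n → ∣ x n ∣ ℚ.≤ K))
  eventuallyBounded x cx with cx 1ℚ (ℚₚ.positive⁻¹ 1ℚ)
  ... | N , close = 1ℚ ℚ.+ ∣ x N ∣
      , ℚₚ.+-mono-<-≤ (ℚₚ.positive⁻¹ 1ℚ) (ℚₚ.0≤∣p∣ (x N))
      , N , λ n N≤n → subst (λ z → ∣ z ∣ ℚ.≤ 1ℚ ℚ.+ ∣ x N ∣)
          (solve 2 (λ a b → (a :- b) :+ b := a) refl (x n) (x N))
          (ℚₚ.≤-trans (ℚₚ.∣p+q∣≤∣p∣+∣q∣ (x n ℚ.- x N) (x N))
            (ℚₚ.+-monoˡ-≤ ∣ x N ∣ (ℚₚ.<⇒≤ (close n N N≤n ℕₚ.≤-refl))))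

  ⊔-≤ˡ : ∀ {M N n} → M ⊔ N ℕ.≤ n → M ℕ.≤ n
  ⊔-≤ˡ {M} {N} = ℕₚ.m⊔n≤o⇒m≤o M N

  ⊔-≤ʳ : ∀ {M N n} → M ⊔ N ℕ.≤ n → N ℕ.≤ n
  ⊔-≤ʳ {M} {N} = ℕₚ.m⊔n≤o⇒n≤o M N

  const-cauchy : ∀ p → IsCauchy (λ _ → p)
  const-cauchy p ε 0<ε = 0 , λ _ _ _ _ →
    subst (λ z → ∣ z ∣ ℚ.< ε) (sym (ℚₚ.+-inverseʳ p)) 0<ε

  +-cauchy : ∀ {x y} → IsCauchy x → IsCauchy y → IsCauchy (λ n → x n ℚ.+ y n)
  +-cauchy {x} {y} cx cy ε 0<ε
    with cx (½ ℚ.* ε) (*-pos 0<½ 0<ε) | cy (½ ℚ.* ε) (*-pos 0<½ 0<ε)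
  ... | M , closeˣ | N , closeʸ = M ⊔ N , λ m n p q →
    subst₂ (λ z e → ∣ z ∣ ℚ.< e)
      (solve 4 (λ a b c d → (a :- c) :+ (b :- d) := (a :+ b) :- (c :+ d)) refl
        (x m) (y m) (x n) (y n))
      (½+½ ε)
      (ℚₚ.≤-<-trans (ℚₚ.∣p+q∣≤∣p∣+∣q∣ (x m ℚ.- x n) (y m ℚ.- y n))
        (ℚₚ.+-mono-< (closeˣ m n (⊔-≤ˡ {M} p) (⊔-≤ˡ {M} q)) (closeʸ m n (⊔-≤ʳ {M} p) (⊔-≤ʳ {M} q))))

  neg-cauchy : ∀ {x} → IsCauchy x → IsCauchy (λ n → ℚ.- x n)
  neg-cauchy {x} cx ε 0<ε with cx ε 0<ε
  ... | N , close = N , λ m n p q →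
    subst (ℚ._< ε)
      (trans (sym (ℚₚ.∣-p∣≡∣p∣ (x m ℚ.- x n)))
        (cong ∣_∣ (solve 2 (λ a b → :- (a :- b) := (:- a) :- (:- b)) refl (x m) (x n))))
      (close m n p q)

  1/⁺ : ∀ K → 0ℚ ℚ.< K → ℚ
  1/⁺ K 0<K = ℚ.1/_ K {{ℚ.>-nonZero 0<K}}

  1/⁺-pos : ∀ K (0<K : 0ℚ ℚ.< K) → 0ℚ ℚ.< 1/⁺ K 0<K
  1/⁺-pos K 0<K = ℚₚ.positive⁻¹ _ {{ℚₚ.1/pos⇒pos K {{ℚ.positive 0<K}}}}

  scaled : ∀ K (0<K : 0ℚ ℚ.< K) ε u d → ∣ u ∣ ℚ.≤ K →
           ∣ d ∣ ℚ.< 1/⁺ K 0<K ℚ.* ε → ∣ u ℚ.* d ∣ ℚ.< ε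
  scaled K 0<K ε u d u≤K d< =
    subst₂ ℚ._<_ (sym (ℚₚ.∣p*q∣≡∣p∣*∣q∣ u d))
      (trans (sym (ℚₚ.*-assoc K (1/⁺ K 0<K) ε))
        (trans (cong (ℚ._* ε) (ℚₚ.*-inverseʳ K {{ℚ.>-nonZero 0<K}})) (ℚₚ.*-identityˡ ε)))
      (ℚₚ.≤-<-trans
        (ℚₚ.*-monoʳ-≤-nonNeg ∣ d ∣ {{ℚₚ.∣-∣-nonNeg d}} u≤K)
        (ℚₚ.*-monoʳ-<-pos K {{ℚ.positive 0<K}} d<))

  *-difference : ∀ a b c d →
    a ℚ.* (b ℚ.- d) ℚ.+ d ℚ.* (a ℚ.- c) ≡ a ℚ.* b ℚ.- c ℚ.* d
  *-difference =
    solve 4 (λ a b c d → a :* (b :- d) :+ d :* (a :- c) := a :* b :- c :* d) refl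

  *-cauchy : ∀ {x y} → IsCauchy x → IsCauchy y → IsCauchy (λ n → x n ℚ.* y n)
  *-cauchy {x} {y} cx cy ε 0<ε = *-close (eventuallyBounded x cx) (eventuallyBounded y cy)
    where
    *-close :
      ∃[ K ] (0ℚ ℚ.< K × ∃[ A ] (∀ n → A ℕ.≤ n → ∣ x n ∣ ℚ.≤ K)) →
      ∃[ L ] (0ℚ ℚ.< L × ∃[ B ] (∀ n → B ℕ.≤ n → ∣ y n ∣ ℚ.≤ L)) →
      ∃[ N ] (∀ m n → N ℕ.≤ m → N ℕ.≤ n → ∣ x m ℚ.* y m ℚ.- x n ℚ.* y n ∣ ℚ.< ε)
    *-close (K , 0<K , A , x≤K) (L , 0<L , B , y≤L) = (A ⊔ B) ⊔ (M ⊔ N) , λ m n p q →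
      subst₂ (λ z e → ∣ z ∣ ℚ.< e)
        (*-difference (x m) (y m) (x n) (y n))
        (½+½ ε)
        (ℚₚ.≤-<-trans (ℚₚ.∣p+q∣≤∣p∣+∣q∣ (x m ℚ.* (y m ℚ.- y n)) (y n ℚ.* (x m ℚ.- x n)))
          (ℚₚ.+-mono-<
            (scaled K 0<K (½ ℚ.* ε) (x m) (y m ℚ.- y n)
              (x≤K m (⊔-≤ˡ {A} (⊔-≤ˡ {A ⊔ B} p)))
              (closeʸ m n (⊔-≤ʳ {M} (⊔-≤ʳ {A ⊔ B} p)) (⊔-≤ʳ {M} (⊔-≤ʳ {A ⊔ B} q))))
            (scaled L 0<L (½ ℚ.* ε) (y n) (x m ℚ.- x n)
              (y≤L n (⊔-≤ʳ {A} (⊔-≤ˡ {A ⊔ B} q)))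
              (closeˣ m n (⊔-≤ˡ {M} (⊔-≤ʳ {A ⊔ B} p)) (⊔-≤ˡ {M} (⊔-≤ʳ {A ⊔ B} q))))))
      where
      εˣ εʸ : ℚ
      εˣ = 1/⁺ L 0<L ℚ.* (½ ℚ.* ε)
      εʸ = 1/⁺ K 0<K ℚ.* (½ ℚ.* ε)
      cauchyˣ : ∃[ M ] (∀ m n → M ℕ.≤ m → M ℕ.≤ n → ∣ x m ℚ.- x n ∣ ℚ.< εˣ)
      cauchyˣ = cx εˣ (*-pos (1/⁺-pos L 0<L) (*-pos 0<½ 0<ε))
      cauchyʸ : ∃[ N ] (∀ m n → N ℕ.≤ m → N ℕ.≤ n → ∣ y m ℚ.- y n ∣ ℚ.< εʸ)
      cauchyʸ = cy εʸ (*-pos (1/⁺-pos K 0<K) (*-pos 0<½ 0<ε))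
      M N : ℕ
      M = proj₁ cauchyˣ
      N = proj₁ cauchyʸ
      closeˣ = proj₂ cauchyˣ
      closeʸ = proj₂ cauchyʸ

open CauchyLemmas

infixl 6 _+_
infixl 7 _*_
infix  8 -_

fromℚ : ℚ → ℝ
fromℚ p = mkℝ (λ _ → p) (const-cauchy p)

fromℤ : ℤ → ℝ
fromℤ i = fromℚ (i ℚ./ 1)

0ℝ 1ℝ : ℝ
0ℝ = fromℚ 0ℚ
1ℝ = fromℚ 1ℚ

_+_ _*_ : ℝ → ℝ → ℝ
x + y = mkℝ (λ n → seq x n ℚ.+ seq y n) (+-cauchy {seq x} {seq y} (cauchy x) (cauchy y))
x * y = mkℝ (λ n → seq x n ℚ.* seq y n) (*-cauchy {seq x} {seq y} (cauchy x) (cauchy y))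

-_ : ℝ → ℝ
- x = mkℝ (λ n → ℚ.- seq x n) (neg-cauchy {seq x} (cauchy x))

ℝ-rawRing : RawRing 0ℓ 0ℓ
ℝ-rawRing = record
  { Carrier = ℝ ; _≈_ = _≈_ ; _+_ = _+_ ; _*_ = _*_ ; -_ = -_ ; 0# = 0ℝ ; 1# = 1ℝ }

-- A positive real may still have finitely many zero terms; these are
-- sent to 0, which does not affect the limit.
recipℚ : ℚ → ℚ
recipℚ p with p ℚₚ.≟ 0ℚ
... | yes _   = 0ℚ
... | no p≢0 = ℚ.1/_ p {{ℚ.≢-nonZero p≢0}}

module RecipLemmas where
  open +-*-Solver

  recipℚ-inverse : ∀ {p} → 0ℚ ℚ.< p → p ℚ.* recipℚ p ≡ 1ℚ
  recipℚ-inverse {p} 0<p with p ℚₚ.≟ 0ℚ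
  ... | yes p≡0 = contradiction (sym p≡0) (ℚₚ.<⇒≢ 0<p)
  ... | no p≢0 = ℚₚ.*-inverseʳ p {{ℚ.≢-nonZero p≢0}}

  recipℚ-bound : ∀ δ (0<δ : 0ℚ ℚ.< δ) p → δ ℚ.≤ p → ∣ recipℚ p ∣ ℚ.≤ 1/⁺ δ 0<δ
  recipℚ-bound δ 0<δ p δ≤p =
    ℚₚ.*-cancelˡ-≤-pos δ {{ℚ.positive 0<δ}}
      (subst (δ ℚ.* ∣ recipℚ p ∣ ℚ.≤_)
        (trans p*∣r∣ (sym (ℚₚ.*-inverseʳ δ {{ℚ.>-nonZero 0<δ}})))
        (ℚₚ.*-monoʳ-≤-nonNeg ∣ recipℚ p ∣ {{ℚₚ.∣-∣-nonNeg (recipℚ p)}} δ≤p))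
    where
    0<p : 0ℚ ℚ.< p
    0<p = ℚₚ.<-≤-trans 0<δ δ≤p
    p*∣r∣ : p ℚ.* ∣ recipℚ p ∣ ≡ 1ℚ
    p*∣r∣ = trans (cong (ℚ._* ∣ recipℚ p ∣) (sym (ℚₚ.0≤p⇒∣p∣≡p (ℚₚ.<⇒≤ 0<p))))
      (trans (sym (ℚₚ.∣p*q∣≡∣p∣*∣q∣ p (recipℚ p))) (cong ∣_∣ (recipℚ-inverse 0<p)))

  *-rearrange : ∀ p q u v →
    u ℚ.* (v ℚ.* (q ℚ.- p)) ≡ u ℚ.* (q ℚ.* v) ℚ.- (p ℚ.* u) ℚ.* v
  *-rearrange =
    solve 4 (λ p q u v → u :* (v :* (q :- p)) := u :* (q :* v) :- (p :* u) :* v) refl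

  recipℚ-difference : ∀ {p q} → 0ℚ ℚ.< p → 0ℚ ℚ.< q →
    recipℚ p ℚ.* (recipℚ q ℚ.* (q ℚ.- p)) ≡ recipℚ p ℚ.- recipℚ q
  recipℚ-difference {p} {q} 0<p 0<q = trans
    (*-rearrange p q (recipℚ p) (recipℚ q))
    (cong₂ ℚ._-_
      (trans (cong (recipℚ p ℚ.*_) (recipℚ-inverse 0<q)) (ℚₚ.*-identityʳ (recipℚ p)))
      (trans (cong (ℚ._* recipℚ q) (recipℚ-inverse 0<p)) (ℚₚ.*-identityˡ (recipℚ q))))

  recip-cauchy : ∀ x → 0ℝ < x → IsCauchy (λ n → recipℚ (seq x n))
  recip-cauchy x (δ , 0<δ , A , δ≤x-0) ε 0<ε = A ⊔ N , λ m n p q →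
    subst (λ z → ∣ z ∣ ℚ.< ε)
      (recipℚ-difference (0<x m (⊔-≤ˡ {A} p)) (0<x n (⊔-≤ˡ {A} q)))
      (scaled δ⁻¹ 0<δ⁻¹ ε (recipℚ (seq x m)) (recipℚ (seq x n) ℚ.* (seq x n ℚ.- seq x m))
        (recipℚ-bound δ 0<δ (seq x m) (δ≤x m (⊔-≤ˡ {A} p)))
        (scaled δ⁻¹ 0<δ⁻¹ ε₁ (recipℚ (seq x n)) (seq x n ℚ.- seq x m)
          (recipℚ-bound δ 0<δ (seq x n) (δ≤x n (⊔-≤ˡ {A} q)))
          (close n m (⊔-≤ʳ {A} q) (⊔-≤ʳ {A} p))))
    where
    δ≤x : ∀ n → A ℕ.≤ n → δ ℚ.≤ seq x n
    δ≤x n A≤n = subst (δ ℚ.≤_) (ℚₚ.+-identityʳ (seq x n)) (δ≤x-0 n A≤n)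
    0<x : ∀ n → A ℕ.≤ n → 0ℚ ℚ.< seq x n
    0<x n A≤n = ℚₚ.<-≤-trans 0<δ (δ≤x n A≤n)
    δ⁻¹ ε₁ ε₂ : ℚ
    δ⁻¹ = 1/⁺ δ 0<δ
    0<δ⁻¹ : 0ℚ ℚ.< δ⁻¹
    0<δ⁻¹ = 1/⁺-pos δ 0<δ
    ε₁ = 1/⁺ δ⁻¹ 0<δ⁻¹ ℚ.* ε
    ε₂ = 1/⁺ δ⁻¹ 0<δ⁻¹ ℚ.* ε₁
    0<ε₂ : 0ℚ ℚ.< ε₂
    0<ε₂ = *-pos (1/⁺-pos δ⁻¹ 0<δ⁻¹) (*-pos (1/⁺-pos δ⁻¹ 0<δ⁻¹) 0<ε)
    N : ℕ
    N = proj₁ (cauchy x ε₂ 0<ε₂)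
    close : ∀ m n → N ℕ.≤ m → N ℕ.≤ n → ∣ seq x m ℚ.- seq x n ∣ ℚ.< ε₂
    close = proj₂ (cauchy x ε₂ 0<ε₂)

open RecipLemmas

recip : (x : ℝ) → 0ℝ < x → ℝ
recip x 0<x = mkℝ (λ n → recipℚ (seq x n)) (recip-cauchy x 0<x)

infixl 7 _÷_[_]

_÷_[_] : ℝ → (y : ℝ) → 0ℝ < y → ℝ
x ÷ y [ 0<y ] = x * recip y 0<y

------------------------------------------------------------------------

∑ ∏ : ∀ {n} → Vector ℝ n → ℝ
∑ = RawMonoidDefs.sum (RawRing.+-rawMonoid ℝ-rawRing)
∏ = RawMonoidDefs.sum (RawRing.*-rawMonoid ℝ-rawRing)

infixr 8 _^_

_^_ : ℝ → ℕ → ℝ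
_^_ = RawSemiringDefs._^_ (RawRing.rawSemiring ℝ-rawRing)

Matrix : ℕ → Set
Matrix n = Fin n → Fin n → ℝ

minor : ∀ {n} → Matrix (suc n) → Fin (suc n) → Fin (suc n) → Matrix n
minor M r c i j = M (punchIn r i) (punchIn c j)

-- Cofactor expansion along the first row.
det : ∀ {n} → Matrix n → ℝ
det {zero}  M = 1ℝ
det {suc n} M =
  ∑ λ j → (- 1ℝ) ^ toℕ j * (M Fin.zero j * det (minor M Fin.zero j))

------------------------------------------------------------------------

-- `factors (factorise n)` lists the prime factors of n with multiplicity.
μ : (n : ℕ) .{{_ : ℕ.NonZero n}} → ℤ
μ n = if does (unique? ℕₚ._≟_ ps) then -1ℤ ℤ.^ length ps else 0ℤ
  where ps = factors (factorise n)

-- The 1-based index represented by an element of Fin n.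
index : ∀ {n} → Fin n → ℕ
index i = suc (toℕ i)

A-R : ∀ {n} → Vector ℝ n → Matrix n
A-R a i j =
  if does (index j ℕₚ.≟ 1) ∧ not (does (index i ℕₚ.≟ 1)) then 1ℝ
  else if does (index i ∣? index j) then a i
  else 0ℝ

{-# OPTIONS --safe #-}

-- Equality of reals only depends on the tails of the sequences, so it is enough
-- to prove the identity for rational aᵢ with inverses bᵢ. Replace the first row
-- of A_R by the combination ∑ᵢ μ(i) bᵢ · (row i), which multiplies the
-- determinant by b₁. Since ∑_{d ∣ j} μ(d) = 0 for j > 1, the new first row is
-- (1 + ∑_{k ≥ 2} μ(k) bₖ , 0 , … , 0), and the remaining minor is upper
-- triangular with diagonal a₂, …, aₙ.
module Submission where

open import Defs hiding (_+_; _*_; -_; _^_)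
open import Algebra.Bundles using (CommutativeRing; RawRing)
import Algebra.Definitions.RawMonoid as RawMonoidDefinitions
import Algebra.Definitions.RawSemiring as RawSemiringDefinitions
import Algebra.Properties.AbelianGroup as AbelianGroupProperties
import Algebra.Properties.Semiring.Sum as SemiringSum
open import Data.Bool.Base using (true; false; if_then_else_; not; _∧_)
open import Data.Bool.Properties using (if-cong)
open import Data.Fin.Base as Fin using (Fin; zero; suc; toℕ; fromℕ<; punchIn; lift)
open import Data.Fin.Properties using (toℕ<n; toℕ-fromℕ<; toℕ-injective; punchInᵢ≢i)
open import Data.Integer.Base as ℤ using (ℤ; 0ℤ; 1ℤ; -1ℤ)
import Data.Integer.Properties as ℤₚ
open import Data.List.Base using (List; []; _∷_; length)
open import Data.List.Relation.Binary.Permutation.Propositional using (_↭_; ↭-sym; ↭⇒↭ₛ)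
open import Data.List.Relation.Binary.Permutation.Propositional.Properties using (↭-length)
import Data.List.Relation.Binary.Permutation.Setoid.Properties as Permutationₛ
open import Data.List.Relation.Unary.All as All using (All; []; _∷_)
open import Data.List.Relation.Unary.AllPairs.Core using ([]; _∷_)
open import Data.List.Relation.Unary.Unique.DecPropositional using (unique?)
open import Data.List.Relation.Unary.Unique.Propositional using (Unique)
open import Data.Nat.Base as ℕ using (ℕ; zero; suc; _≤_; s≤s; z≤n; _⊔_; NonZero)
open import Data.Nat.Divisibility
open import Data.Nat.ListAction using (product)
open import Data.Nat.Primality using (Prime; euclidsLemma; prime⇒nonZero)
open import Data.Nat.Primality.Factorisation
import Data.Nat.Properties as ℕₚ
open import Data.Product.Base using (∃-syntax; _×_; _,_; proj₁; proj₂)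
open import Data.Rational.Base as ℚ using (ℚ; 0ℚ; 1ℚ; ½; _/_; +-*-rawRing)
import Data.Rational.Properties as ℚₚ
open import Data.Rational.Solver using (module +-*-Solver)
open import Data.Sum.Base using (inj₁; inj₂)
open import Data.Vec.Functional using (Vector; tail) renaming (_∷_ to _◂_)
open import Function.Base using (_∘_)
open import Function.Bundles using (mk⇔)
open import Relation.Binary.PropositionalEquality
open import Relation.Nullary using (¬_; Dec; does; yes; no; contradiction)
open import Relation.Nullary.Decidable using (dec-true; dec-false; does-⇔)

open ≡-Reasoning
open PrimeFactorisation using (isFactorisation; factorsPrime)

private
  module ℚ-ring = CommutativeRing ℚₚ.+-*-commutativeRing

module OverRationals where

  open import Data.Rational.Base using (_+_; _*_; -_; _-_)
  open SemiringSum ℚ-ring.semiring public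
    using (sum; sum-cong-≗; sum-remove; sum-replicate-zero; ∑-distrib-+; ∑-comm; *-distribˡ-sum)
  open RawSemiringDefinitions (RawRing.rawSemiring +-*-rawRing) public using () renaming (_^_ to _ℚ^_)
  open AbelianGroupProperties ℚ-ring.+-abelianGroup using (identityˡ-unique) renaming (⁻¹-involutive to neg-involutive)

  -- Finite sums and products over the rationals

  prod : ∀ {n} → Vector ℚ n → ℚ
  prod = RawMonoidDefinitions.sum (RawRing.*-rawMonoid +-*-rawRing)

  prod-cong : ∀ {n} {f g : Vector ℚ n} → (∀ i → f i ≡ g i) → prod f ≡ prod g
  prod-cong {zero}  f≡g = refl
  prod-cong {suc n} f≡g = cong₂ _*_ (f≡g zero) (prod-cong (f≡g ∘ suc))

  sum-zero : ∀ {n} (f : Vector ℚ n) → (∀ i → f i ≡ 0ℚ) → sum f ≡ 0ℚ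
  sum-zero {n} f f≡0 = trans (sum-cong-≗ f≡0) (sum-replicate-zero n)

  sum-single : ∀ {n} (f : Vector ℚ n) i → (∀ j → j ≢ i → f j ≡ 0ℚ) → sum f ≡ f i
  sum-single {suc n} f i f≡0 = begin
    sum f                        ≡⟨ sum-remove {i = i} f ⟩
    f i + sum (f ∘ punchIn i)    ≡⟨ cong (f i +_) (sum-zero _ λ j → f≡0 _ (punchInᵢ≢i i j)) ⟩
    f i + 0ℚ                     ≡⟨ ℚₚ.+-identityʳ (f i) ⟩
    f i                          ∎

  sum-head : ∀ {n} (f : Vector ℚ (suc n)) → (∀ i → f (suc i) ≡ 0ℚ) → sum f ≡ f zero
  sum-head f f≡0 = trans (cong (f zero +_) (sum-zero _ f≡0)) (ℚₚ.+-identityʳ (f zero))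

  -- Determinants

  Matrixℚ : ℕ → Set
  Matrixℚ n = Fin n → Fin n → ℚ

  sign : ∀ {n} → Fin n → ℚ
  sign j = (- 1ℚ) ℚ^ toℕ j

  -- The expansion of a determinant along its first row r; D g stands for the
  -- minor of the remaining rows in the columns selected by g.
  laplace : ∀ {n} → Vector ℚ (suc n) → ((Fin n → Fin (suc n)) → ℚ) → ℚ
  laplace r D = sum λ j → sign j * (r j * D (punchIn j))

  -- The bracketing copies `det`, so the two can be compared term by term; the successor case
  -- unfolds to `laplace` of the first row.
  detℚ : ∀ {n} → Matrixℚ n → ℚ
  detℚ {zero}  M = 1ℚ
  detℚ {suc n} M = sum λ j → sign j * (M zero j * detℚ (λ i k → M (suc i) (punchIn j k)))

  laplace-congˡ : ∀ {n} {r s : Vector ℚ (suc n)} D → (∀ j → r j ≡ s j) → laplace r D ≡ laplace s D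
  laplace-congˡ D r≡s = sum-cong-≗ λ j → cong (λ x → sign j * (x * D (punchIn j))) (r≡s j)

  laplace-congʳ : ∀ {n} (r : Vector ℚ (suc n)) D E → (∀ j → D (punchIn j) ≡ E (punchIn j)) →
    laplace r D ≡ laplace r E
  laplace-congʳ r D E D≡E = sum-cong-≗ λ j → cong (λ x → sign j * (r j * x)) (D≡E j)

  detℚ-cong : ∀ {n} {M N : Matrixℚ n} → (∀ i j → M i j ≡ N i j) → detℚ M ≡ detℚ N
  detℚ-cong {zero}  M≡N = refl
  detℚ-cong {suc n} {M} {N} M≡N = sum-cong-≗ λ j → cong (sign j *_)
    (cong₂ _*_ (M≡N zero j) (detℚ-cong λ i k → M≡N (suc i) (punchIn j k)))

  term-zeroˡ : ∀ s x {r} → r ≡ 0ℚ → s * (r * x) ≡ 0ℚ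
  term-zeroˡ s x refl = trans (cong (s *_) (ℚₚ.*-zeroˡ x)) (ℚₚ.*-zeroʳ s)

  term-zeroʳ : ∀ s r {x} → x ≡ 0ℚ → s * (r * x) ≡ 0ℚ
  term-zeroʳ s r refl = trans (cong (s *_) (ℚₚ.*-zeroʳ r)) (ℚₚ.*-zeroʳ s)

  -- Linearity in the first row, by exchanging the sum over columns with the sum over the combined
  -- rows.
  laplace-linear : ∀ {k n} (c : Vector ℚ k) (R : Fin k → Vector ℚ (suc n)) D →
    laplace (λ j → sum λ i → c i * R i j) D ≡ sum λ i → c i * laplace (R i) D
  laplace-linear c R D = begin
    (sum λ j → sign j * (sum (λ i → c i * R i j) * D (punchIn j)))
      ≡⟨ sum-cong-≗ (λ j → trans
           (solve 3 (λ e x d → e :* (x :* d) := (e :* d) :* x) refl (sign j) _ (D (punchIn j)))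
           (*-distribˡ-sum (sign j * D (punchIn j)) (λ i → c i * R i j))) ⟩
    (sum λ j → sum λ i → sign j * D (punchIn j) * (c i * R i j))
      ≡⟨ ∑-comm (λ j i → sign j * D (punchIn j) * (c i * R i j)) ⟩
    (sum λ i → sum λ j → sign j * D (punchIn j) * (c i * R i j))
      ≡⟨ sum-cong-≗ (λ i → trans
           (sum-cong-≗ λ j → solve 4 (λ e d x r → (e :* d) :* (x :* r) := x :* (e :* (r :* d)))
              refl (sign j) (D (punchIn j)) (c i) (R i j))
           (sym (*-distribˡ-sum (c i) (λ j → sign j * (R i j * D (punchIn j)))))) ⟩
    (sum λ i → c i * laplace (R i) D) ∎
    where
    open +-*-Solver

  -- Antisymmetry of the expansion along two rows

  laplace₂ : ∀ {n} → Vector ℚ (2 ℕ.+ n) → Vector ℚ (2 ℕ.+ n) → ((Fin n → Fin (2 ℕ.+ n)) → ℚ) → ℚ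
  laplace₂ r s D = laplace r (λ g → laplace (s ∘ g) (λ h → D (g ∘ h)))

  -- Composites of `punchIn` match the column selections wanted only pointwise, so a minor `D` has
  -- to respect pointwise equality.
  Extensional : ∀ {m n} → ((Fin m → Fin n) → ℚ) → Set
  Extensional D = ∀ g h → (∀ k → g k ≡ h k) → D g ≡ D h

  -- The part of laplace₂ in which neither row uses the first column.
  laplace₂-tail : ∀ {n} → Vector ℚ (2 ℕ.+ n) → Vector ℚ (2 ℕ.+ n) → ((Fin n → Fin (2 ℕ.+ n)) → ℚ) → ℚ
  laplace₂-tail {zero}  r s D = 0ℚ
  laplace₂-tail {suc n} r s D = laplace₂ (r ∘ suc) (s ∘ suc) (D ∘ lift 1)

  -- `punchIn (suc j) ∘ punchIn (suc k)` fixes `zero` and shifts `punchIn j ∘ punchIn k` elsewhere,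
  -- so it agrees pointwise with its `lift 1`. For `n = zero` the inner sum is empty.
  laplace₂-tail-expand : ∀ {n} r s (D : (Fin n → Fin (2 ℕ.+ n)) → ℚ) → Extensional D →
    (sum λ j → sign j * (r (suc j) *
      (sum λ k → sign k * (s (suc (punchIn j k)) * D (punchIn (suc j) ∘ punchIn (suc k))))))
    ≡ laplace₂-tail r s D
  laplace₂-tail-expand {zero}  r s D ext = sum-zero _ λ j → term-zeroʳ (sign j) (r (suc j)) refl
  laplace₂-tail-expand {suc n} r s D ext = sum-cong-≗ λ j →
    cong (λ x → sign j * (r (suc j) * x)) (sum-cong-≗ λ k →
      cong (λ x → sign k * (s (suc (punchIn j k)) * x)) (ext
        (punchIn (suc j) ∘ punchIn (suc k)) (lift 1 (punchIn j ∘ punchIn k)) λ { zero → refl ; (suc i) → refl }))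

  -- The three terms record which row uses column `zero`: `r`, `s` or neither. If `s` does, shifting
  -- the column of `r` costs one factor -1; if neither does, the two shifts cancel.
  laplace₂-step : ∀ {n} r s (D : (Fin n → Fin (2 ℕ.+ n)) → ℚ) → Extensional D →
    laplace₂ r s D ≡
      r zero * laplace (s ∘ suc) (λ g → D (suc ∘ g)) - s zero * laplace (r ∘ suc) (λ g → D (suc ∘ g))
      + laplace₂-tail r s D
  laplace₂-step {n} r s D ext = begin
    1ℚ * (r zero * X) + (sum λ j → (- 1ℚ * sign j) * (r (suc j) * (1ℚ * (s zero * D′ j) + Z⁻ j)))
      ≡⟨ cong (1ℚ * (r zero * X) +_) (sum-cong-≗ λ j →
           cong (λ z → (- 1ℚ * sign j) * (r (suc j) * (1ℚ * (s zero * D′ j) + z))) (Z⁻≡-Z j)) ⟩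
    1ℚ * (r zero * X) + (sum λ j → (- 1ℚ * sign j) * (r (suc j) * (1ℚ * (s zero * D′ j) + - 1ℚ * Z j)))
      ≡⟨ cong (1ℚ * (r zero * X) +_) (trans
           (sum-cong-≗ λ j → solve 5 (λ e x y d z →
              (con (- 1ℚ) :* e) :* (x :* (con 1ℚ :* (y :* d) :+ con (- 1ℚ) :* z))
                := (:- y) :* (e :* (x :* d)) :+ e :* (x :* z))
              refl (sign j) (r (suc j)) (s zero) (D′ j) (Z j))
           (∑-distrib-+ (λ j → (- s zero) * (sign j * (r (suc j) * D′ j))) (λ j → sign j * (r (suc j) * Z j)))) ⟩
    1ℚ * (r zero * X) + ((sum λ j → (- s zero) * (sign j * (r (suc j) * D′ j))) + W)
      ≡⟨ cong₂ (λ y w → 1ℚ * (r zero * X) + (y + w))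
           (sym (*-distribˡ-sum (- s zero) (λ j → sign j * (r (suc j) * D′ j)))) (laplace₂-tail-expand r s D ext) ⟩
    1ℚ * (r zero * X) + ((- s zero) * Y + laplace₂-tail r s D)
      ≡⟨ solve 5 (λ a x b y w → con 1ℚ :* (a :* x) :+ ((:- b) :* y :+ w) := (a :* x :- b :* y) :+ w)
           refl (r zero) X (s zero) Y (laplace₂-tail r s D) ⟩
    r zero * X - s zero * Y + laplace₂-tail r s D ∎
    where
    open +-*-Solver
    D′ : Fin (suc n) → ℚ
    D′ j = D (suc ∘ punchIn j)
    X Y W : ℚ
    X = laplace (s ∘ suc) (λ g → D (suc ∘ g))
    Y = laplace (r ∘ suc) (λ g → D (suc ∘ g))
    z : Fin (suc n) → Fin n → ℚ
    z j k = s (suc (punchIn j k)) * D (punchIn (suc j) ∘ punchIn (suc k))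
    Z Z⁻ : Fin (suc n) → ℚ
    Z j = sum λ k → sign k * z j k
    Z⁻ j = sum λ k → (- 1ℚ * sign k) * z j k
    Z⁻≡-Z : ∀ j → Z⁻ j ≡ - 1ℚ * Z j
    Z⁻≡-Z j = trans (sum-cong-≗ λ k → ℚₚ.*-assoc (- 1ℚ) (sign k) (z j k))
      (sym (*-distribˡ-sum (- 1ℚ) (λ k → sign k * z j k)))
    W = sum λ j → sign j * (r (suc j) * Z j)

  -- Induction on the number of columns: exchanging `r` and `s` negates the first two terms of
  -- `laplace₂-step`, and the tail is a double expansion with one column fewer.
  laplace₂-antisym : ∀ {n} r s (D : (Fin n → Fin (2 ℕ.+ n)) → ℚ) → Extensional D →
    laplace₂ r s D + laplace₂ s r D ≡ 0ℚ
  laplace₂-tail-antisym : ∀ {n} r s (D : (Fin n → Fin (2 ℕ.+ n)) → ℚ) → Extensional D →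
    laplace₂-tail r s D + laplace₂-tail s r D ≡ 0ℚ

  laplace₂-antisym r s D ext = begin
    laplace₂ r s D + laplace₂ s r D
      ≡⟨ cong₂ _+_ (laplace₂-step r s D ext) (laplace₂-step s r D ext) ⟩
    (x - y + laplace₂-tail r s D) + (y - x + laplace₂-tail s r D)
      ≡⟨ solve 4 (λ x y t u → (x :- y :+ t) :+ (y :- x :+ u) := t :+ u) refl x y _ _ ⟩
    laplace₂-tail r s D + laplace₂-tail s r D
      ≡⟨ laplace₂-tail-antisym r s D ext ⟩
    0ℚ ∎
    where
    open +-*-Solver
    x y : ℚ
    x = r zero * laplace (s ∘ suc) (λ g → D (suc ∘ g))
    y = s zero * laplace (r ∘ suc) (λ g → D (suc ∘ g))

  laplace₂-tail-antisym {zero}  r s D ext = refl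
  laplace₂-tail-antisym {suc n} r s D ext =
    laplace₂-antisym (r ∘ suc) (s ∘ suc) (D ∘ lift 1)
      λ g h g≡h → ext (lift 1 g) (lift 1 h) λ { zero → refl ; (suc i) → cong suc (g≡h i) }

  x+x≡0⇒x≡0 : ∀ x → x + x ≡ 0ℚ → x ≡ 0ℚ
  x+x≡0⇒x≡0 x x+x≡0 = begin
    x             ≡⟨ solve 1 (λ x → x := con ½ :* (x :+ x)) refl x ⟩
    ½ * (x + x)   ≡⟨ cong (½ *_) x+x≡0 ⟩
    ½ * 0ℚ        ≡⟨⟩
    0ℚ            ∎
    where open +-*-Solver

  -- If the repeated rows are adjacent, antisymmetry makes twice the determinant vanish; otherwise
  -- induction on `i` moves them closer.
  detℚ-repeated-row : ∀ {n} (M : Matrixℚ (suc n)) i → (∀ k → M zero k ≡ M (suc i) k) → detℚ M ≡ 0ℚ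
  detℚ-repeated-row {suc n} M i eq = by-row i eq
    where
    rest : (Fin n → Fin (2 ℕ.+ n)) → ℚ
    rest g = detℚ λ i k → M (suc (suc i)) (g k)
    rest-ext : Extensional rest
    rest-ext g h g≡h = detℚ-cong λ i k → cong (M (suc (suc i))) (g≡h k)
    E : (s : Vector ℚ (2 ℕ.+ n)) → (Fin (suc n) → Fin (2 ℕ.+ n)) → ℚ
    E s g = laplace (s ∘ g) (λ h → rest (g ∘ h))
    by-row : ∀ i → (∀ k → M zero k ≡ M (suc i) k) → detℚ M ≡ 0ℚ
    by-row zero eq = begin
      laplace (M zero) (E (M (suc zero)))
        ≡⟨ laplace-congʳ (M zero) (E (M (suc zero))) (E (M zero)) (λ j →
             laplace-congˡ (λ h → rest (punchIn j ∘ h)) (λ k → sym (eq (punchIn j k)))) ⟩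
      laplace₂ (M zero) (M zero) rest
        ≡⟨ x+x≡0⇒x≡0 _ (laplace₂-antisym (M zero) (M zero) rest rest-ext) ⟩
      0ℚ ∎
    -- Swapping the first two rows makes the repetition visible in each minor.
    by-row (suc i) eq = begin
      x               ≡⟨ ℚₚ.+-identityʳ x ⟨
      x + 0ℚ          ≡⟨ cong (x +_) (sym swapped) ⟩
      x + laplace₂ (M (suc zero)) (M zero) rest
        ≡⟨ laplace₂-antisym (M zero) (M (suc zero)) rest rest-ext ⟩
      0ℚ ∎
      where
      x : ℚ
      x = laplace₂ (M zero) (M (suc zero)) rest
      swapped : laplace₂ (M (suc zero)) (M zero) rest ≡ 0ℚ
      swapped = sum-zero _ λ j → term-zeroʳ (sign j) (M (suc zero) j)
        (detℚ-repeated-row (λ { zero k → M zero (punchIn j k) ; (suc i) k → M (suc (suc i)) (punchIn j k) })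
          i (λ k → eq (punchIn j k)))

  -- Zero columns and triangular matrices

  detℚ-zero-column : ∀ {n} (M : Matrixℚ (suc n)) → (∀ i → M i zero ≡ 0ℚ) → detℚ M ≡ 0ℚ
  detℚ-zero-column {n} M eq = sum-zero _ (term n M eq)
    where
    term : ∀ n (M : Matrixℚ (suc n)) → (∀ i → M i zero ≡ 0ℚ) → ∀ j →
      sign j * (M zero j * detℚ (λ i k → M (suc i) (punchIn j k))) ≡ 0ℚ
    term n       M eq zero    = term-zeroˡ 1ℚ (detℚ λ i k → M (suc i) (suc k)) (eq zero)
    term (suc n) M eq (suc j) = term-zeroʳ (sign (suc j)) (M zero (suc j))
      (detℚ-zero-column (λ i k → M (suc i) (punchIn (suc j) k)) (λ i → eq (suc i)))

  -- Only the first term of the expansion survives: every other minor keeps the first column, which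
  -- is zero below the diagonal.
  detℚ-upper-triangular : ∀ {n} (M : Matrixℚ n) → (∀ i j → j Fin.< i → M i j ≡ 0ℚ) →
    detℚ M ≡ prod λ i → M i i
  detℚ-upper-triangular {zero}  M lower≡0 = refl
  detℚ-upper-triangular {suc n} M lower≡0 = begin
    detℚ M
      ≡⟨ sum-head (λ j → sign j * (M zero j * detℚ (λ i k → M (suc i) (punchIn j k)))) (off-diagonal M lower≡0) ⟩
    1ℚ * (M zero zero * detℚ (λ i k → M (suc i) (suc k)))
      ≡⟨ ℚₚ.*-identityˡ _ ⟩
    M zero zero * detℚ (λ i k → M (suc i) (suc k))
      ≡⟨ cong (M zero zero *_) (detℚ-upper-triangular (λ i k → M (suc i) (suc k))
           λ i j j<i → lower≡0 (suc i) (suc j) (s≤s j<i)) ⟩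
    (prod λ i → M i i) ∎
    where
    off-diagonal : ∀ {n} (M : Matrixℚ (suc n)) → (∀ i j → j Fin.< i → M i j ≡ 0ℚ) → ∀ j →
      sign (suc j) * (M zero (suc j) * detℚ (λ i k → M (suc i) (punchIn (suc j) k))) ≡ 0ℚ
    off-diagonal {suc n} M lower≡0 j = term-zeroʳ (sign (suc j)) (M zero (suc j))
      (detℚ-zero-column (λ i k → M (suc i) (punchIn (suc j) k)) λ i → lower≡0 (suc i) zero (s≤s z≤n))

  -- The Möbius function

  μ-list : List ℕ → ℤ
  μ-list ps = if does (unique? ℕₚ._≟_ ps) then -1ℤ ℤ.^ length ps else 0ℤ

  μ-list-unique : ∀ ps → Unique ps → μ-list ps ≡ -1ℤ ℤ.^ length ps
  μ-list-unique ps u = if-cong (dec-true (unique? ℕₚ._≟_ ps) u)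

  μ-list-repeated : ∀ ps → ¬ Unique ps → μ-list ps ≡ 0ℤ
  μ-list-repeated ps ¬u = if-cong (dec-false (unique? ℕₚ._≟_ ps) ¬u)

  μ-list-↭ : ∀ {ps qs} → ps ↭ qs → μ-list ps ≡ μ-list qs
  μ-list-↭ {ps} {qs} ps↭qs = cong₂ (λ b l → if b then -1ℤ ℤ.^ l else 0ℤ)
    (does-⇔ (mk⇔ (unique-↭ ps↭qs) (unique-↭ (↭-sym ps↭qs))) (unique? ℕₚ._≟_ ps) (unique? ℕₚ._≟_ qs))
    (↭-length ps↭qs)
    where
    unique-↭ : ∀ {xs ys} → xs ↭ ys → Unique xs → Unique ys
    unique-↭ xs↭ys = Permutationₛ.Unique-resp-↭ (setoid ℕ) (↭⇒↭ₛ xs↭ys)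

  -- Unique factorisation lets `μ` be read off any prime factorisation, not just the one computed by
  -- `factorise`.
  μ-factors : ∀ {n} .{{_ : NonZero n}} (f : PrimeFactorisation n) → μ n ≡ μ-list (factors f)
  μ-factors {n} f = μ-list-↭ (factorisationUnique (factorise n) f)

  factorisation-* : ∀ {p n} → Prime p → PrimeFactorisation n → PrimeFactorisation (p ℕ.* n)
  factorisation-* {p} pr f = record
    { factors         = p ∷ factors f
    ; isFactorisation = cong (p ℕ.*_) (isFactorisation f)
    ; factorsPrime    = pr ∷ factorsPrime f
    }

  -- Prepending a prime absent from the factor list adds one to the length and creates no
  -- repetition.
  μ-prime-* : ∀ {p n} .{{_ : NonZero n}} .{{_ : NonZero (p ℕ.* n)}} →
    Prime p → p ∤ n → μ (p ℕ.* n) ≡ ℤ.- μ n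
  μ-prime-* {p} {n} pr p∤n = trans (μ-factors (factorisation-* pr f)) split
    where
    f : PrimeFactorisation n
    f = factorise n
    ps : List ℕ
    ps = factors f
    -- Each member of a list divides its product, so `p` cannot be a member.
    p∉ : ∀ {qs} → p ∤ product qs → All (p ≢_) qs
    p∉ {[]}     _   = []
    p∉ {q ∷ qs} p∤Π =
      (λ { refl → p∤Π (m∣m*n (product qs)) }) ∷ p∉ (λ p∣Π → p∤Π (∣n⇒∣m*n q p∣Π))
    p∉ps : All (p ≢_) ps
    p∉ps = p∉ λ p∣Π → p∤n (subst (p ∣_) (sym (isFactorisation f)) p∣Π)
    split : μ-list (p ∷ ps) ≡ ℤ.- μ-list ps
    split = cases (unique? ℕₚ._≟_ ps)
      where
      cases : Dec (Unique ps) → μ-list (p ∷ ps) ≡ ℤ.- μ-list ps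
      cases (yes u) = trans (μ-list-unique (p ∷ ps) (p∉ps ∷ u))
        (trans (ℤₚ.-1*i≡-i _) (cong ℤ.-_ (sym (μ-list-unique ps u))))
      cases (no ¬u) = trans (μ-list-repeated (p ∷ ps) λ { (_ ∷ u) → ¬u u })
        (cong ℤ.-_ (sym (μ-list-repeated ps ¬u)))

  -- Here `p` already occurs among the prime factors of `n`, so prepending it creates a repetition.
  μ-prime-*-∣ : ∀ {p n} .{{_ : NonZero n}} .{{_ : NonZero (p ℕ.* n)}} →
    Prime p → p ∣ n → μ (p ℕ.* n) ≡ 0ℤ
  μ-prime-*-∣ {p} {n} pr p∣n = trans (μ-factors (factorisation-* pr f))
    (μ-list-repeated (p ∷ factors f) λ { (p∉ ∷ _) → All.lookup p∉ p∈ refl })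
    where
    f : PrimeFactorisation n
    f = factorise n
    p∈ = factorisationHasAllPrimeFactors pr (subst (p ∣_) (isFactorisation f) p∣n) (factorsPrime f)

  prime-divisor : ∀ n → ∃[ p ] (Prime p × p ∣ 2 ℕ.+ n)
  prime-divisor n with factorise (2 ℕ.+ n)
  ... | record { factors = [] ; isFactorisation = () }
  ... | record { factors = p ∷ ps ; isFactorisation = eq ; factorsPrime = pr ∷ _ } =
    p , pr , subst (p ∣_) (sym eq) (m∣m*n (product ps))

  -- Divisor sums of the Möbius function

  neg-/1 : ∀ i → (ℤ.- i) / 1 ≡ - (i / 1)
  neg-/1 (ℤ.+ zero)  = refl
  neg-/1 ℤ.+[1+ n ]  = refl
  neg-/1 ℤ.-[1+ n ]  = sym (neg-involutive _)

  index-injective : ∀ {n} {i j : Fin n} → index i ≡ index j → i ≡ j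
  index-injective eq = toℕ-injective (ℕₚ.suc-injective eq)

  index-surjective : ∀ {n} t .{{_ : NonZero t}} → t ≤ n → ∃[ i ] index {n} i ≡ t
  index-surjective (suc t) t<n = fromℕ< t<n , cong suc (toℕ-fromℕ< t<n)

  -- For a prime p ∣ K, the terms of ∑_{d ∣ K} μ(d) with p ∤ d cancel against those
  -- with d = p e and p ∤ e, and the terms with p² ∣ d vanish. Below, u e is the
  -- term at e if p ∤ e and 0 otherwise, and w e k places u e at the index k = p e.
  ∑μ≡0-prime : ∀ n K .{{_ : NonZero K}} p → Prime p → p ∣ K → K ≤ n →
    (sum λ (i : Fin n) → if does (index i ∣? K) then μ (index i) / 1 else 0ℚ) ≡ 0ℚ
  ∑μ≡0-prime n K p pr p∣K K≤n = identityˡ-unique _ (sum u) (begin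
    sum t + sum u
      ≡⟨ cong (sum t +_) (sum-cong-≗ (λ e → sym (∑ₖw e))) ⟩
    sum t + sum (λ e → sum (w e))
      ≡⟨ cong (sum t +_) (∑-comm w) ⟩
    sum t + (sum λ k → sum λ e → w e k)
      ≡⟨ ∑-distrib-+ t (λ k → sum λ e → w e k) ⟨
    sum (λ k → t k + sum λ e → w e k)
      ≡⟨ sum-cong-≗ T+∑ₑw ⟩
    sum u ∎)
    where
    instance
      p≢0 : NonZero p
      p≢0 = prime⇒nonZero pr

    T : (m : ℕ) .{{_ : NonZero m}} → ℚ
    T m = if does (m ∣? K) then μ m / 1 else 0ℚ
    t u : Vector ℚ n
    t k = T (index k)
    u e = if does (p ∣? index e) then 0ℚ else T (index e)
    w : Fin n → Fin n → ℚ
    w e k = if does (index k ℕₚ.≟ p ℕ.* index e) then u e else 0ℚ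

    T-∣ : ∀ m .{{_ : NonZero m}} → m ∣ K → T m ≡ μ m / 1
    T-∣ m m∣K = if-cong (dec-true (m ∣? K) m∣K)
    T-∤ : ∀ m .{{_ : NonZero m}} → m ∤ K → T m ≡ 0ℚ
    T-∤ m m∤K = if-cong (dec-false (m ∣? K) m∤K)
    u-∣ : ∀ e → p ∣ index e → u e ≡ 0ℚ
    u-∣ e p∣e = if-cong (dec-true (p ∣? index e) p∣e)
    u-∤ : ∀ e → p ∤ index e → u e ≡ T (index e)
    u-∤ e p∤e = if-cong (dec-false (p ∣? index e) p∤e)
    w-≡ : ∀ e k → index k ≡ p ℕ.* index e → w e k ≡ u e
    w-≡ e k eq = if-cong (dec-true (index k ℕₚ.≟ p ℕ.* index e) eq)
    w-≢ : ∀ e k → index k ≢ p ℕ.* index e → w e k ≡ 0ℚ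
    w-≢ e k neq = if-cong (dec-false (index k ℕₚ.≟ p ℕ.* index e) neq)

    -- In `K = q * m` the prime `p` must divide the cofactor `q`. Hence each divisor prime to `p`
    -- has its partner `p * m` among the divisors too.
    p*m∣K : ∀ m → p ∤ m → m ∣ K → p ℕ.* m ∣ K
    p*m∣K m p∤m (divides q K≡q*m) with euclidsLemma q m pr (subst (p ∣_) K≡q*m p∣K)
    ... | inj₁ p∣q = subst (p ℕ.* m ∣_) (sym K≡q*m) (*-monoˡ-∣ m p∣q)
    ... | inj₂ p∣m = contradiction p∣m p∤m

    u-support : ∀ e → p ℕ.* index e ∤ K → u e ≡ 0ℚ
    u-support e pe∤K with p ∣? index e
    ... | yes p∣e = refl
    ... | no p∤e = T-∤ (index e) λ e∣K → pe∤K (p*m∣K (index e) p∤e e∣K)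

    -- Row `e` can be nonzero only at the index `p * index e`. That index is in range if it divides
    -- `K`, as `K ≤ n`; otherwise `u e` is zero anyway.
    ∑ₖw : ∀ e → (sum λ k → w e k) ≡ u e
    ∑ₖw e with p ℕ.* index e ∣? K
    ... | no pe∤K = trans (sum-zero _ w≡0) (sym u≡0)
      where
      u≡0 : u e ≡ 0ℚ
      u≡0 = u-support e pe∤K
      w≡0 : ∀ k → w e k ≡ 0ℚ
      w≡0 k with index k ℕₚ.≟ p ℕ.* index e
      ... | yes eq = trans (w-≡ e k eq) u≡0
      ... | no neq = w-≢ e k neq
    ... | yes pe∣K with index-surjective (p ℕ.* index e) {{ℕₚ.m*n≢0 p (index e)}} (ℕₚ.≤-trans (∣⇒≤ pe∣K) K≤n)
    ...   | k₀ , eq₀ = trans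
      (sum-single (w e) k₀ λ k k≢k₀ → w-≢ e k λ eq → k≢k₀ (index-injective (trans eq (sym eq₀))))
      (w-≡ e k₀ eq₀)

    -- The cancellation of partners. The variable `m` allows matching on `refl`, which `index k`
    -- would block.
    T+u : ∀ m .{{_ : NonZero m}} e → m ≡ p ℕ.* index e → T m + u e ≡ 0ℚ
    T+u .(p ℕ.* index e) e refl = cases (p ∣? index e) (p ℕ.* index e ∣? K)
      where
      cases : Dec (p ∣ index e) → Dec (p ℕ.* index e ∣ K) → T (p ℕ.* index e) + u e ≡ 0ℚ
      cases _ (no pe∤K) = cong₂ _+_ (T-∤ (p ℕ.* index e) pe∤K) (u-support e pe∤K)
      cases (yes p∣e) (yes pe∣K) = cong₂ _+_
        (trans (T-∣ (p ℕ.* index e) pe∣K) (cong (_/ 1) (μ-prime-*-∣ pr p∣e))) (u-∣ e p∣e)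
      cases (no p∤e) (yes pe∣K) = trans
        (cong₂ _+_
          (trans (T-∣ (p ℕ.* index e) pe∣K)
            (trans (cong (_/ 1) (μ-prime-* pr p∤e)) (neg-/1 (μ (index e)))))
          (trans (u-∤ e p∤e) (T-∣ (index e) (∣-trans (n∣m*n p) pe∣K))))
        (ℚₚ.+-inverseˡ (μ (index e) / 1))

    -- Column `k` of `w` can be nonzero only at the row of index `index k / p`, which exists only if
    -- `p` divides `index k`.
    T+∑ₑw : ∀ k → T (index k) + (sum λ e → w e k) ≡ u k
    T+∑ₑw k = cases (p ∣? index k)
      where
      cases : Dec (p ∣ index k) → T (index k) + (sum λ e → w e k) ≡ u k
      cases (no p∤k) = begin
        T (index k) + (sum λ e → w e k)
          ≡⟨ cong (T (index k) +_) (sum-zero _ λ e → w-≢ e k λ eq →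
               p∤k (subst (p ∣_) (sym eq) (m∣m*n (index e)))) ⟩
        T (index k) + 0ℚ  ≡⟨ ℚₚ.+-identityʳ _ ⟩
        T (index k)       ≡⟨ u-∤ k p∤k ⟨
        u k               ∎
      -- The quotient is positive because `index k` is, and it is at most `n` because it divides
      -- `index k`.
      cases (yes p∣k@(divides (suc q) eq))
        with index-surjective (suc q) (ℕₚ.≤-trans (∣⇒≤ (divides p (trans eq (ℕₚ.*-comm (suc q) p)))) (toℕ<n k))
      ... | e₀ , eq₀ = begin
        T (index k) + (sum λ e → w e k)
          ≡⟨ cong (T (index k) +_) (trans
               (sum-single (λ e → w e k) e₀ λ e e≢e₀ → w-≢ e k λ eq₁ →
                 e≢e₀ (index-injective (ℕₚ.*-cancelˡ-≡ _ _ p (trans (sym eq₁) k≡p*e₀))))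
               (w-≡ e₀ k k≡p*e₀)) ⟩
        T (index k) + u e₀  ≡⟨ T+u (index k) e₀ k≡p*e₀ ⟩
        0ℚ                  ≡⟨ u-∣ k p∣k ⟨
        u k                 ∎
        where
        k≡p*e₀ : index k ≡ p ℕ.* index e₀
        k≡p*e₀ = trans eq (trans (ℕₚ.*-comm (suc q) p) (cong (p ℕ.*_) (sym eq₀)))

  ∑μ≡0 : ∀ n N → 2 ℕ.+ N ≤ n →
    (sum λ (i : Fin n) → if does (index i ∣? 2 ℕ.+ N) then μ (index i) / 1 else 0ℚ) ≡ 0ℚ
  ∑μ≡0 n N N≤n with prime-divisor N
  ... | p , pr , p∣N = ∑μ≡0-prime n (2 ℕ.+ N) p pr p∣N N≤n

  -- The determinant over ℚ

  A-Rℚ : ∀ {n} → Vector ℚ n → Matrixℚ n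
  A-Rℚ a i j =
    if does (index j ℕₚ.≟ 1) ∧ not (does (index i ℕₚ.≟ 1)) then 1ℚ
    else if does (index i ∣? index j) then a i
    else 0ℚ

  -- Here `f` stands for the Möbius values and `b` for the inverses of `a`; only the value at 1 and
  -- the vanishing divisor sums of `f` enter.
  detℚ-A-Rℚ : ∀ m (f a b : Vector ℚ (suc m)) → f zero ≡ 1ℚ →
    (∀ j → (sum λ i → if does (index i ∣? index (Fin.suc j)) then f i else 0ℚ) ≡ 0ℚ) →
    (∀ i → a i * b i ≡ 1ℚ) →
    detℚ (A-Rℚ a) ≡ prod a * (1ℚ + sum λ (i : Fin m) → f (suc i) * b (suc i))
  detℚ-A-Rℚ m f a b f₀ ∑f≡0 ab≡1 = begin
    detℚ A                               ≡⟨ ℚₚ.*-identityˡ (detℚ A) ⟨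
    1ℚ * detℚ A                          ≡⟨ cong (_* detℚ A) (ab≡1 zero) ⟨
    a zero * b zero * detℚ A             ≡⟨ ℚₚ.*-assoc (a zero) (b zero) (detℚ A) ⟩
    a zero * (b zero * detℚ A)           ≡⟨ cong (a zero *_) (trans (sym combined) reduced) ⟩
    a zero * ((1ℚ + S) * prod (tail a))
      ≡⟨ solve 3 (λ a s q → a :* (s :* q) := (a :* q) :* s) refl (a zero) (1ℚ + S) (prod (tail a)) ⟩
    prod a * (1ℚ + S)                    ∎
    where
    open +-*-Solver
    A : Matrixℚ (suc m)
    A = A-Rℚ a
    c : Vector ℚ (suc m)
    c i = f i * b i
    S : ℚ
    S = sum (tail c)
    rest : (Fin m → Fin (suc m)) → ℚ
    rest g = detℚ λ i k → A (suc i) (g k)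
    R : Vector ℚ (suc m)
    R j = sum λ i → c i * A i j

    c₀ : c zero ≡ b zero
    c₀ = trans (cong (_* b zero) f₀) (ℚₚ.*-identityˡ (b zero))

    combined : laplace R rest ≡ b zero * detℚ A
    combined = begin
      laplace R rest                          ≡⟨ laplace-linear c A rest ⟩
      (sum λ i → c i * laplace (A i) rest)    ≡⟨ sum-head (λ i → c i * laplace (A i) rest) other-rows ⟩
      c zero * detℚ A                         ≡⟨ cong (_* detℚ A) c₀ ⟩
      b zero * detℚ A                         ∎
      where
      other-rows : ∀ i → c (suc i) * laplace (A (suc i)) rest ≡ 0ℚ
      other-rows i = trans
        -- `laplace (A (suc i)) rest` is the determinant of `A` with its first row replaced by row
        -- `suc i`, so it has two equal rows.
        (cong (c (suc i) *_) (detℚ-repeated-row (A (suc i) ◂ tail A) i λ _ → refl))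
        (ℚₚ.*-zeroʳ (c (suc i)))

    -- The first column of `A` is `a zero` followed by ones, so the inverses in `c` survive
    -- uncancelled below the top entry.
    R₀ : R zero ≡ 1ℚ + S
    R₀ = cong₂ _+_
      (trans (cong₂ _*_ c₀ refl) (trans (ℚₚ.*-comm (b zero) (a zero)) (ab≡1 zero)))
      (sum-cong-≗ λ i → ℚₚ.*-identityʳ (c (suc i)))

    -- Beyond the first column an entry is `a i` or zero; `a i` cancels `b i` and leaves a divisor
    -- sum of `f`.
    R₊ : ∀ j → R (suc j) ≡ 0ℚ
    R₊ j = trans (sum-cong-≗ term) (∑f≡0 j)
      where
      term : ∀ i → c i * A i (suc j) ≡ (if does (index i ∣? index (suc j)) then f i else 0ℚ)
      term i with does (index i ∣? index (suc j))
      ... | true = begin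
        f i * b i * a i
          ≡⟨ solve 3 (λ m b a → (m :* b) :* a := m :* (a :* b)) refl (f i) (b i) (a i) ⟩
        f i * (a i * b i)   ≡⟨ cong (f i *_) (ab≡1 i) ⟩
        f i * 1ℚ            ≡⟨ ℚₚ.*-identityʳ _ ⟩
        f i                   ∎
      ... | false = ℚₚ.*-zeroʳ (c i)

    lower≡0 : ∀ i j → j Fin.< i → A (suc i) (suc j) ≡ 0ℚ
    lower≡0 i j j<i = if-cong (dec-false (index (suc i) ∣? index (suc j))
      λ i∣j → ℕₚ.<⇒≱ (s≤s (s≤s j<i)) (∣⇒≤ i∣j))

    diagonal : ∀ i → A (suc i) (suc i) ≡ a (suc i)
    diagonal i = if-cong (dec-true (index (suc i) ∣? index (suc i)) ∣-refl)

    reduced : laplace R rest ≡ (1ℚ + S) * prod (tail a)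
    reduced = begin
      laplace R rest
        ≡⟨ sum-head (λ j → sign j * (R j * rest (punchIn j))) (λ j → term-zeroˡ (sign (suc j)) (rest (punchIn (suc j))) (R₊ j)) ⟩
      1ℚ * (R zero * rest suc)
        ≡⟨ ℚₚ.*-identityˡ _ ⟩
      R zero * rest suc
        ≡⟨ cong₂ _*_ R₀ (trans (detℚ-upper-triangular (λ i k → A (suc i) (suc k)) lower≡0) (prod-cong diagonal)) ⟩
      (1ℚ + S) * prod (tail a) ∎

-- Transfer to ℝ

open OverRationals
open Defs using (_+_; _*_; -_; _^_)

-- Real operations act termwise, so each term of a real expression is the same expression over the
-- rationals; likewise for the next four lemmas.
seq-∑ : ∀ {k} (f : Vector ℝ k) n → seq (∑ f) n ≡ sum λ i → seq (f i) n
seq-∑ {zero}  f n = refl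
seq-∑ {suc k} f n = cong (seq (f zero) n ℚ.+_) (seq-∑ (tail f) n)

seq-∏ : ∀ {k} (f : Vector ℝ k) n → seq (∏ f) n ≡ prod λ i → seq (f i) n
seq-∏ {zero}  f n = refl
seq-∏ {suc k} f n = cong (seq (f zero) n ℚ.*_) (seq-∏ (tail f) n)

seq-^ : ∀ x k n → seq (x ^ k) n ≡ seq x n ℚ^ k
seq-^ x zero    n = refl
seq-^ x (suc k) n = cong (seq x n ℚ.*_) (seq-^ x k n)

seq-det : ∀ {k} (M : Matrix k) n → seq (det M) n ≡ detℚ λ i j → seq (M i j) n
seq-det {zero}  M n = refl
seq-det {suc k} M n = trans (seq-∑ (λ j → (- 1ℝ) ^ toℕ j * (M zero j * det (minor M zero j))) n) (sum-cong-≗ λ j →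
  cong₂ (λ s d → s ℚ.* (seq (M zero j) n ℚ.* d)) (seq-^ (- 1ℝ) (toℕ j) n)
    (seq-det (minor M zero j) n))

seq-A-R : ∀ {k} (a : Vector ℝ k) n i j → seq (A-R a i j) n ≡ A-Rℚ (λ i → seq (a i) n) i j
seq-A-R a n i j with does (index j ℕₚ.≟ 1) ∧ not (does (index i ℕₚ.≟ 1)) | does (index i ∣? index j)
... | true  | _     = refl
... | false | true  = refl
... | false | false = refl

eventually-≡⇒≈ : ∀ {x y} N → (∀ n → N ≤ n → seq x n ≡ seq y n) → x ≈ y
eventually-≡⇒≈ {x} {y} N x≡y ε 0<ε = N , λ n N≤n →
  subst (λ z → ℚ.∣ z ∣ ℚ.< ε) (sym (trans (cong (ℚ._- seq y n) (x≡y n N≤n)) (ℚₚ.+-inverseʳ (seq y n)))) 0<ε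

eventually-∀ : ∀ {k} {P : Fin k → ℕ → Set} → (∀ i → ∃[ N ] (∀ n → N ≤ n → P i n)) →
  ∃[ N ] (∀ n → N ≤ n → ∀ i → P i n)
eventually-∀ {zero}  ev = 0 , λ _ _ ()
eventually-∀ {suc k} ev with ev zero | eventually-∀ (λ i → ev (suc i))
... | M , p | N , q = M ⊔ N , λ where
  n M⊔N≤n zero    → p n (ℕₚ.m⊔n≤o⇒m≤o M N M⊔N≤n)
  n M⊔N≤n (suc i) → q n (ℕₚ.m⊔n≤o⇒n≤o M N M⊔N≤n) i

-- Past the threshold supplied by positivity the terms are at least `δ`, so the default value of
-- `recipℚ` at zero no longer occurs.
eventually-invertible : ∀ x → 0ℝ < x → ∃[ N ] (∀ n → N ≤ n → seq x n ℚ.* recipℚ (seq x n) ≡ 1ℚ)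
eventually-invertible x (δ , 0<δ , N , δ≤) = N , λ n N≤n → RecipLemmas.recipℚ-inverse
  (ℚₚ.<-≤-trans 0<δ (subst (δ ℚ.≤_) (ℚₚ.+-identityʳ (seq x n)) (δ≤ n N≤n)))

det-A-R : ∀ m (f : Fin (suc m) → ℤ) (a : Vector ℝ (suc m)) (a>0 : ∀ i → 0ℝ < a i) → f zero ≡ 1ℤ →
  (∀ j → (sum λ i → if does (index i ∣? index (Fin.suc j)) then f i / 1 else 0ℚ) ≡ 0ℚ) →
  det (A-R a) ≈ ∏ a * (1ℝ + ∑ (λ (i : Fin m) → fromℤ (f (suc i)) ÷ a (suc i) [ a>0 (suc i) ]))
det-A-R m f a a>0 f₀ ∑f≡0 = eventually-≡⇒≈ {det (A-R a)} {∏ a * (1ℝ + ∑ g)} (proj₁ inv) λ n N≤n → begin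
  seq (det (A-R a)) n
    ≡⟨ seq-det (A-R a) n ⟩
  detℚ (λ i j → seq (A-R a i j) n)
    ≡⟨ detℚ-cong (seq-A-R a n) ⟩
  detℚ (A-Rℚ λ i → seq (a i) n)
    ≡⟨ detℚ-A-Rℚ m (λ i → f i / 1) (λ i → seq (a i) n) (λ i → recipℚ (seq (a i) n))
         (cong (_/ 1) f₀) ∑f≡0 (proj₂ inv n N≤n) ⟩
  prod (λ i → seq (a i) n) ℚ.* (1ℚ ℚ.+ sum (λ i → seq (g i) n))
    ≡⟨ cong₂ (λ p s → p ℚ.* (1ℚ ℚ.+ s)) (seq-∏ a n) (seq-∑ g n) ⟨
  seq (∏ a * (1ℝ + ∑ g)) n ∎
  where
  inv : ∃[ N ] (∀ n → N ≤ n → ∀ i → seq (a i) n ℚ.* recipℚ (seq (a i) n) ≡ 1ℚ)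
  inv = eventually-∀ λ i → eventually-invertible (a i) (a>0 i)
  g : Vector ℝ m
  g i = fromℤ (f (suc i)) ÷ a (suc i) [ a>0 (suc i) ]

theorem6 : (m : ℕ) (a : Vector ℝ (suc m)) (a>0 : ∀ i → 0ℝ < a i) →
    det (A-R a) ≈ ∏ a * (1ℝ + ∑ (λ (i : Fin m) → fromℤ (μ (index (suc i))) ÷ a (suc i) [ a>0 (suc i) ]))
theorem6 m a a>0 = det-A-R m (λ i → μ (index i)) a a>0 refl
  -- Column `suc j` has 1-based index `2 + toℕ j`, which is at most the matrix size `suc m`.
  λ j → ∑μ≡0 (suc m) (toℕ j) (s≤s (toℕ<n j))
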